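{- Let $B>3$ be an odd integer, and let $c_{\max}(B)$ be the largest length of a terminal cycle of the four-digit Kaprekar map in base $B$. If $c_{\max}(B)=\frac{B-1}{2}$ (so that $B$ is prime), then the number of terminal cycles of length $c_{\max}(B)$ is $$\left\lfloor\frac{c_{\max}(B)-1}{2}\right\rfloor.$$
   Context: A four-digit string in base $B$ is a sequence of four digits in $\{0,\dots,B-1\}$ (leading zeros allowed). The four-digit Kaprekar map in base $B$ sends a string whose digits sorted in non-increasing order are $a_1\ge a_2\ge a_3\ge a_4$ to the four-digit base-$B$ string (with leading zeros if needed) of the number $$(a_1B^3+a_2B^2+a_3B+a_4)-(a_4B^3+a_3B^2+a_2B+a_1).$$ Constant strings (all four digits equal) are excluded throughout. A terminal cycle is a periodic orbit of this map consisting of nonconstant strings, and its length is the number of distinct strings in it (the minimal period). -}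

module Defs where

open import Data.Digit using (Digit; fromDigits)
open import Data.Fin using (Fin)
open import Data.Fin.Properties using (≤-decTotalOrder)
import Data.List as List
open import Data.List.Sort.InsertionSort using (insertionSort)
open import Data.List.Sort.Base using (module SortingAlgorithm)
open import Data.Nat using (ℕ; _+_; _*_; _∸_; _/_; _≤_; _<_; NonZero)
open import Data.Nat.DivMod using (_mod_)
open import Data.Nat.GeneralisedArithmetic using (iterate)
open import Data.Product using (Σ; ∃; _×_; proj₁)
open import Data.Vec using (Vec; []; _∷_; toList; replicate)
open import Function.Bundles using (Bijection)
open import Level using (0ℓ)
open import Relation.Binary.Bundles using (Setoid)
import Relation.Binary.Construct.On as On
open import Relation.Binary.PropositionalEquality using (_≡_; _≢_; setoid)
open import Relation.Nullary using (¬_)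
open import Relation.Unary using (Pred)
open import Relation.Unary.Relation.Binary.Equality using (≐-setoid)

-- Four-digit strings, most significant digit first.
DigitString : ℕ → Set
DigitString B = Vec (Digit B) 4

Constant : ∀ {B} → DigitString B → Set
Constant s = ∃ λ d → s ≡ replicate 4 d

module _ (B : ℕ) .{{_ : NonZero B}} where

  fourDigits : ℕ → DigitString B
  fourDigits n = ((n / B / B / B) mod B) ∷ ((n / B / B) mod B) ∷ ((n / B) mod B) ∷ (n mod B) ∷ []

  -- `ascending` is a₄ ≤ a₃ ≤ a₂ ≤ a₁.  Since `fromDigits` reads the least
  -- significant digit first, it sends this list to a₁B³ + a₂B² + a₃B + a₄.
  -- The truncated subtraction is never truncated, and the difference is
  -- always less than B⁴, so `fourDigits` loses nothing.
  kaprekar : DigitString B → DigitString B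
  kaprekar s = fourDigits (fromDigits ascending ∸ fromDigits (List.reverse ascending))
    where
    open SortingAlgorithm (insertionSort (≤-decTotalOrder B)) using (sort)
    ascending : List.List (Digit B)
    ascending = sort (toList s)

  -- A terminal cycle, presented by a starting string on it together with its
  -- minimal period; presentations of the same cycle are identified by
  -- `cyclesOfLength` below.
  record TerminalCycle : Set where
    field
      start       : DigitString B
      length      : ℕ
      positive    : 0 < length
      periodic    : iterate kaprekar start length ≡ start
      minimal     : ∀ j → 0 < j → j < length → iterate kaprekar start j ≢ start
      nonconstant : ∀ j → ¬ Constant (iterate kaprekar start j)

  open TerminalCycle

  orbit : TerminalCycle → Pred (DigitString B) 0ℓ
  orbit γ t = ∃ λ j → iterate kaprekar (start γ) j ≡ t

  -- Two cycles are equal when they consist of the same strings.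
  cyclesOfLength : ℕ → Setoid 0ℓ 0ℓ
  cyclesOfLength c =
    On.setoid {B = Σ TerminalCycle λ γ → length γ ≡ c}
      (≐-setoid (DigitString B) 0ℓ) (λ γ → orbit (proj₁ γ))

  -- c = c_max(B)
  IsLargestCycleLength : ℕ → Set
  IsLargestCycleLength c =
    (∃ λ (γ : TerminalCycle) → length γ ≡ c) × (∀ (γ : TerminalCycle) → length γ ≤ c)

HasCardinality : Setoid 0ℓ 0ℓ → ℕ → Set
HasCardinality S k = Bijection (setoid (Fin k)) S

{-# OPTIONS --safe #-}

-- A nonconstant string enters the map only through x = a₁ − a₄ and y = a₂ − a₃.  For odd B
-- the next pair of differences is, up to order, ∣2x − B∣ and ∣2y − B∣, except when y = 0 or
-- when these two numbers agree; an orbit leaves the exceptional pairs within a few steps and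
-- never returns.  So a terminal cycle is an orbit of unordered pairs of distinct odd numbers
-- below B = 2n + 1 under x ↦ ∣2x − B∣, that is, under doubling on (ℤ/B)/±1.  Doubling is
-- linear, so once a power of it fixes 1 it fixes everything.  A cycle of length n thus forces
-- the n odd numbers to form the single orbit of 1; each is then coprime to B, and B is prime.
-- On pairs at distance d along this orbit the period is n, or n / 2 if 2d = n, and the
-- distances d and n − d give the same cycle, whence one cycle for each 0 < d < n / 2.

module Submission where

open import Defs
open import Data.Digit using (Digit; fromDigits)
open import Data.Fin.Base using (Fin; zero; suc; toℕ; fromℕ<)
import Data.Fin.Properties as Fin
open import Data.Integer.Base as ℤ using (ℤ; 1ℤ) renaming (+_ to pos)
import Data.Integer.Divisibility.Signed as ℤ
import Data.Integer.Properties as ℤ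
import Data.Integer.Tactic.RingSolver as ℤ-Solver
open import Data.List.Base as List using (List; []; _∷_)
open import Data.List.Relation.Binary.Permutation.Propositional
  using (_↭_; prep; swap; ↭-refl; ↭-reflexive; ↭-sym; ↭-trans; ↭⇒↭ₛ)
open import Data.List.Relation.Binary.Permutation.Propositional.Properties
  using (map⁺; All-resp-↭; ++⁺; ↭-length)
open import Data.List.Relation.Binary.Pointwise using (Pointwise-≡⇒≡)
open import Data.List.Relation.Unary.All using (All; []; _∷_)
open import Data.List.Relation.Unary.Linked using ([-]; _∷_)
import Data.List.Relation.Unary.Sorted.TotalOrder as Sorted
open import Data.List.Relation.Unary.Sorted.TotalOrder.Properties using (↗↭↗⇒≋)
open import Data.List.Sort.Base using (module SortingAlgorithm)
open import Data.List.Sort.InsertionSort using (insertionSort)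
open import Data.Nat.Base
open import Data.Nat.Coprimality using (Coprime; coprime-divisor)
open import Data.Nat.Divisibility
open import Data.Nat.DivMod
open import Data.Nat.GeneralisedArithmetic using (iterate)
open import Data.Nat.Primality using (Prime; prime; Composite; composite)
open import Data.Nat.Properties
open import Data.Nat.Tactic.RingSolver using (solve-∀)
open import Data.Product.Base using (∃; ∃₂; _×_; _,_; proj₁; proj₂)
open import Data.Sum.Base using (_⊎_; inj₁; inj₂)
open import Data.Vec.Base using ([]; _∷_; toList; replicate)
open import Data.Vec.Properties using (∷-injective)
open import Relation.Binary.Bundles using (Setoid)
open import Relation.Binary.Definitions using (tri<; tri≈; tri>)
open import Relation.Binary.PropositionalEquality
open import Relation.Nullary using (¬_; yes; no; contradiction)

-- Iterates of a periodic point

module _ {A : Set} (f : A → A) where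

  iterate-+ : ∀ x a b → iterate f x (a + b) ≡ iterate f (iterate f x a) b
  iterate-+ x zero    b = refl
  iterate-+ x (suc a) b = iterate-+ (f x) a b

  iterate-period : ∀ {x L} → iterate f x L ≡ x → ∀ a → iterate f x (a * L) ≡ x
  iterate-period             eq zero    = refl
  iterate-period {x} {L} eq (suc a) =
    trans (iterate-+ x L (a * L)) (trans (cong (λ y → iterate f y (a * L)) eq) (iterate-period eq a))

  -- Any point of a cycle leads back to its start: `a` steps are completed to `a` full turns. Since
  -- `L` is positive, `a * L ∸ a` is not truncated.
  iterate-return : ∀ {x L} → 0 < L → iterate f x L ≡ x → ∀ a → iterate f (iterate f x a) (a * L ∸ a) ≡ x
  iterate-return {x} {L@(suc _)} 0<L eq a = begin
    iterate f (iterate f x a) (a * L ∸ a) ≡⟨ iterate-+ x a (a * L ∸ a) ⟨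
    iterate f x (a + (a * L ∸ a))         ≡⟨ cong (iterate f x) (m+[n∸m]≡n (m≤m*n a L)) ⟩
    iterate f x (a * L)                   ≡⟨ iterate-period eq a ⟩
    x                                     ∎
    where open ≡-Reasoning

-- Parity

odd : ℕ → ℕ
odd i = suc (i + i)

2*-double : ∀ i → 2 * i ≡ i + i
2*-double = solve-∀

odd-injective : ∀ {i j} → odd i ≡ odd j → i ≡ j
odd-injective {i} {j} eq = *-cancelˡ-≡ i j 2 (begin
  2 * i ≡⟨ 2*-double i ⟩
  i + i ≡⟨ suc-injective eq ⟩
  j + j ≡⟨ 2*-double j ⟨
  2 * j ∎)
  where open ≡-Reasoning

double≢odd : ∀ i j → i + i ≢ odd j
double≢odd i j eq = even≢odd i j (begin
  2 * i       ≡⟨ 2*-double i ⟩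
  i + i       ≡⟨ eq ⟩
  odd j       ≡⟨ cong suc (2*-double j) ⟨
  suc (2 * j) ∎)
  where open ≡-Reasoning

even-or-odd : ∀ m → (∃ λ i → m ≡ i + i) ⊎ (∃ λ i → m ≡ odd i)
even-or-odd zero    = inj₁ (0 , refl)
even-or-odd (suc m) with even-or-odd m
... | inj₁ (i , refl) = inj₂ (i , refl)
... | inj₂ (i , refl) = inj₁ (suc i , cong suc (sym (+-suc i i)))

odd-mono-< : ∀ {i j} → i < j → odd i < odd j
odd-mono-< i<j = s<s (+-mono-< i<j i<j)

odd-cancel-< : ∀ {i j} → odd i < odd j → i < j
odd-cancel-< {i} {j} lt with i <? j
... | yes i<j = i<j
... | no  i≮j = contradiction (s≤s (+-mono-≤ (≮⇒≥ i≮j) (≮⇒≥ i≮j))) (<⇒≱ lt)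

coprime-odd-2 : ∀ i → Coprime (odd i) 2
coprime-odd-2 i {d} (d∣odd , d∣2) = ∣1⇒≡1 (∣m+n∣m⇒∣n (subst (d ∣_) (+-comm 1 (i + i)) d∣odd)
  (subst (d ∣_) (2*-double i) (∣m⇒∣m*n i d∣2)))

-- Doubling modulo an odd number, up to sign

module Doubling (n : ℕ) where

  -- odd i = ∣2x − odd n∣
  data Fold (x i : ℕ) : Set where
    low  : x + i ≡ n       → Fold x i
    high : x ≡ suc (n + i) → Fold x i

  -- At least one of the two truncated differences vanishes, so the sum covers both cases of `Fold`
  -- at once.
  fold : ℕ → ℕ
  fold x = (n ∸ x) + (x ∸ suc n)

  fold-view : ∀ x → Fold x (fold x)
  fold-view x with x ≤? n
  ... | yes x≤n rewrite m≤n⇒m∸n≡0 (m≤n⇒m≤1+n x≤n) | +-identityʳ (n ∸ x) = low (m+[n∸m]≡n x≤n)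
  ... | no  x≰n rewrite m≤n⇒m∸n≡0 (<⇒≤ (≰⇒> x≰n)) = high (sym (m+[n∸m]≡n (≰⇒> x≰n)))

  Fold-< : ∀ {x i} → 0 < x → x < odd n → Fold x i → i < n
  Fold-< 0<x _   (low refl)  = m<n+m _ 0<x
  Fold-< _   x<B (high refl) = +-cancelˡ-< n _ _ (s<s⁻¹ x<B)

  Fold-injective : ∀ {x y i} → Fold x i → Fold y i → x ≡ y ⊎ x + y ≡ odd n
  Fold-injective {x} {y} {i} (low p)     (low q)     = inj₁ (+-cancelʳ-≡ i x y (trans p (sym q)))
  Fold-injective {x} {_} {i} (low p)     (high refl) =
    inj₂ (trans (identity x n i) (cong (λ k → suc (n + k)) p))
    where
    identity : ∀ x n i → x + suc (n + i) ≡ suc (n + (x + i))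
    identity = solve-∀
  Fold-injective {_} {y} {i} (high refl) (low q)     =
    inj₂ (trans (identity y n i) (cong (λ k → suc (n + k)) q))
    where
    identity : ∀ y n i → suc (n + i) + y ≡ suc (n + (y + i))
    identity = solve-∀
  Fold-injective (high p) (high q) = inj₁ (trans p (sym q))

  -- Of x and `odd n` - x exactly one is odd, so the odd numbers below `odd n` represent the nonzero
  -- classes up to sign. `t` is doubling of these classes, written on the indices of the odd
  -- representatives.
  t : ℕ → ℕ
  t i = fold (odd i)

  t-< : ∀ {i} → i < n → t i < n
  t-< {i} i<n = Fold-< z<s (odd-mono-< i<n) (fold-view (odd i))

  -- `Fold` confuses x only with `odd n` - x, and two odd numbers cannot add up to an odd one.
  t-injective : ∀ {i j} → t i ≡ t j → i ≡ j
  t-injective {i} {j} eq with Fold-injective (fold-view (odd i)) (subst (Fold (odd j)) (sym eq) (fold-view (odd j)))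
  ... | inj₁ p = odd-injective p
  ... | inj₂ p = contradiction (trans (identity i j) p) (double≢odd (suc (i + j)) n)
    where
    identity : ∀ i j → suc (i + j) + suc (i + j) ≡ suc (i + i) + suc (j + j)
    identity = solve-∀

  iterate-t-< : ∀ {i} → i < n → ∀ k → iterate t i k < n
  iterate-t-< i<n zero    = i<n
  iterate-t-< i<n (suc k) = iterate-t-< (t-< i<n) k

  iterate-t-injective : ∀ {i j} k → iterate t i k ≡ iterate t j k → i ≡ j
  iterate-t-injective zero    eq = eq
  iterate-t-injective (suc k) eq = t-injective (iterate-t-injective k eq)

  modulus : ℤ
  modulus = pos (odd n)

  infix 4 _≈_
  data _≈_ (a b : ℤ) : Set where
    same     : modulus ℤ.∣ a ℤ.- b → a ≈ b
    opposite : modulus ℤ.∣ a ℤ.+ b → a ≈ b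

  ≈-sym : ∀ {a b} → a ≈ b → b ≈ a
  ≈-sym {a} {b} (same p) = same (subst (modulus ℤ.∣_) (identity a b) (ℤ.∣m⇒∣-m p))
    where
    identity : ∀ a b → ℤ.- (a ℤ.- b) ≡ b ℤ.- a
    identity = ℤ-Solver.solve-∀
  ≈-sym {a} {b} (opposite p) = opposite (subst (modulus ℤ.∣_) (ℤ.+-comm a b) p)

  ≈-trans : ∀ {a b c} → a ≈ b → b ≈ c → a ≈ c
  ≈-trans {a} {b} {c} (same p) (same q) = same (subst (modulus ℤ.∣_) (identity a b c) (ℤ.∣m∣n⇒∣m+n p q))
    where
    identity : ∀ a b c → (a ℤ.- b) ℤ.+ (b ℤ.- c) ≡ a ℤ.- c
    identity = ℤ-Solver.solve-∀
  ≈-trans {a} {b} {c} (same p) (opposite q) = opposite (subst (modulus ℤ.∣_) (identity a b c) (ℤ.∣m∣n⇒∣m+n p q))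
    where
    identity : ∀ a b c → (a ℤ.- b) ℤ.+ (b ℤ.+ c) ≡ a ℤ.+ c
    identity = ℤ-Solver.solve-∀
  ≈-trans {a} {b} {c} (opposite p) (same q) = opposite (subst (modulus ℤ.∣_) (identity a b c) (ℤ.∣m∣n⇒∣m-n p q))
    where
    identity : ∀ a b c → (a ℤ.+ b) ℤ.- (b ℤ.- c) ≡ a ℤ.+ c
    identity = ℤ-Solver.solve-∀
  ≈-trans {a} {b} {c} (opposite p) (opposite q) = same (subst (modulus ℤ.∣_) (identity a b c) (ℤ.∣m∣n⇒∣m-n p q))
    where
    identity : ∀ a b c → (a ℤ.+ b) ℤ.- (b ℤ.+ c) ≡ a ℤ.- c
    identity = ℤ-Solver.solve-∀

  *-congˡ-≈ : ∀ c {a b} → a ≈ b → c ℤ.* a ≈ c ℤ.* b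
  *-congˡ-≈ c {a} {b} (same p) = same (subst (modulus ℤ.∣_) (identity a b c) (ℤ.∣n⇒∣m*n c p))
    where
    identity : ∀ a b c → c ℤ.* (a ℤ.- b) ≡ c ℤ.* a ℤ.- c ℤ.* b
    identity = ℤ-Solver.solve-∀
  *-congˡ-≈ c {a} {b} (opposite p) = opposite (subst (modulus ℤ.∣_) (ℤ.*-distribˡ-+ c a b) (ℤ.∣n⇒∣m*n c p))

  -- Removing the absolute value leaves `odd i` + 2x = `odd n` in the low case and `odd i` - 2x =
  -- -`odd n` in the high case, whence the quotients 1 and -1.
  Fold-≈ : ∀ {x i} → Fold x i → pos (odd i) ≈ pos 2 ℤ.* pos x
  Fold-≈ {x} {i} (low refl)  = opposite (ℤ.divides 1ℤ (identity (pos x) (pos i)))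
    where
    identity : ∀ x i → (1ℤ ℤ.+ (i ℤ.+ i)) ℤ.+ pos 2 ℤ.* x
                     ≡ 1ℤ ℤ.* (1ℤ ℤ.+ ((x ℤ.+ i) ℤ.+ (x ℤ.+ i)))
    identity = ℤ-Solver.solve-∀
  Fold-≈ {x} {i} (high refl) = same (ℤ.divides (ℤ.- 1ℤ) (identity (pos n) (pos i)))
    where
    identity : ∀ n i → (1ℤ ℤ.+ (i ℤ.+ i)) ℤ.- pos 2 ℤ.* (1ℤ ℤ.+ (n ℤ.+ i))
                     ≡ (ℤ.- 1ℤ) ℤ.* (1ℤ ℤ.+ (n ℤ.+ n))
    identity = ℤ-Solver.solve-∀

  -- Linearity: multiplication by `c` commutes with each doubling. Both indices move along in the
  -- induction.
  iterate-t-≈ : ∀ k {i j} c → pos (odd i) ≈ c ℤ.* pos (odd j) → pos (odd (iterate t i k)) ≈ c ℤ.* pos (odd (iterate t j k))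
  iterate-t-≈ zero            c eq = eq
  iterate-t-≈ (suc k) {i} {j} c eq = iterate-t-≈ k c
    (≈-trans (Fold-≈ (fold-view (odd i)))
    (≈-trans (*-congˡ-≈ (pos 2) eq)
    (subst (_≈ c ℤ.* pos (odd (t j))) (swap-factors c (pos (odd j)))
      (*-congˡ-≈ c (≈-sym (Fold-≈ (fold-view (odd j))))))))
    where
    swap-factors : ∀ c x → c ℤ.* (pos 2 ℤ.* x) ≡ pos 2 ℤ.* (c ℤ.* x)
    swap-factors = ℤ-Solver.solve-∀

  -- The difference of two odd numbers below the modulus is smaller than the modulus, so it vanishes
  -- once divisible by it. Their sum is 2(i + j + 1); the odd modulus would divide i + j + 1, which
  -- is positive and too small.
  ≈⇒≡ : ∀ {i j} → i < n → j < n → pos (odd i) ≈ pos (odd j) → i ≡ j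
  ≈⇒≡ {i} {j} i<n j<n (same p) = odd-injective (ℤ.+-injective (ℤ.i-j≡0⇒i≡j (pos (odd i)) (pos (odd j))
    (ℤ.∣i∣≡0⇒i≡0 (vanish _ small (ℤ.∣⇒∣ᵤ p)))))
    where
    small : ℤ.∣ pos (odd i) ℤ.- pos (odd j) ∣ < odd n
    small = begin-strict
      ℤ.∣ pos (odd i) ℤ.- pos (odd j) ∣ ≡⟨ cong ℤ.∣_∣ (ℤ.m-n≡m⊖n (odd i) (odd j)) ⟩
      ℤ.∣ odd i ℤ.⊖ odd j ∣     ≤⟨ ℤ.∣m⊝n∣≤m⊔n (odd i) (odd j) ⟩
      odd i ⊔ odd j             <⟨ ⊔-lub (odd-mono-< i<n) (odd-mono-< j<n) ⟩
      odd n                     ∎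
      where open ≤-Reasoning
    vanish : ∀ m → m < odd n → odd n ∣ m → m ≡ 0
    vanish zero    _  _ = refl
    vanish (suc m) lt d = contradiction d (>⇒∤ lt)
  ≈⇒≡ {i} {j} i<n j<n (opposite p) = contradiction
    (coprime-divisor (coprime-odd-2 n) (subst (odd n ∣_) (identity i j) (ℤ.∣⇒∣ᵤ p)))
    (>⇒∤ (s<s (+-mono-< i<n j<n)))
    where
    identity : ∀ i j → suc (i + i) + suc (j + j) ≡ 2 * suc (i + j)
    identity = solve-∀

  -- Linearity with factor `odd i`, starting from `odd 0` = 1: the orbit of `odd i` is `odd i` times
  -- the orbit of 1, up to sign.
  iterate-t-fixes : ∀ m → 0 < n → iterate t 0 m ≡ 0 → ∀ {i} → i < n → iterate t i m ≡ i
  iterate-t-fixes m 0<n eq {i} i<n = ≈⇒≡ (iterate-t-< i<n m) i<n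
    (subst (pos (odd (iterate t i m)) ≈_)
      (trans (cong (λ j → pos (odd i) ℤ.* pos (odd j)) eq) (ℤ.*-identityʳ (pos (odd i))))
      (iterate-t-≈ m {i} {0} (pos (odd i)) (same (ℤ.divides (pos 0) (zero-identity (pos (odd i)) modulus)))))
    where
    zero-identity : ∀ x b → x ℤ.- x ℤ.* 1ℤ ≡ pos 0 ℤ.* b
    zero-identity = ℤ-Solver.solve-∀

  -- A common divisor of B and ∣2x - B∣ divides 2x, and being coprime to 2 it divides x. Divisors
  -- thus travel backwards along an orbit, which `odd-n-prime` exploits.
  ∣-Fold : ∀ {d x i} → Coprime d 2 → d ∣ odd n → Fold x i → d ∣ odd i → d ∣ x
  ∣-Fold {d} {x} {i} d⊥2 d∣B (low refl) d∣i = coprime-divisor d⊥2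
    (∣m+n∣m⇒∣n (subst (d ∣_) (identity x i) d∣B) d∣i)
    where
    identity : ∀ x i → suc (x + i + (x + i)) ≡ suc (i + i) + 2 * x
    identity = solve-∀
  ∣-Fold {d} {x} {i} d⊥2 d∣B (high refl) d∣i = coprime-divisor d⊥2
    (subst (d ∣_) (identity n i) (∣m∣n⇒∣m+n d∣B d∣i))
    where
    identity : ∀ n i → suc (n + n) + suc (i + i) ≡ 2 * suc (n + i)
    identity = solve-∀

  ∣-iterate-t : ∀ {d} → Coprime d 2 → d ∣ odd n → ∀ k {i} → d ∣ odd (iterate t i k) → d ∣ odd i
  ∣-iterate-t d⊥2 d∣B zero    d∣i = d∣i
  ∣-iterate-t d⊥2 d∣B (suc k) {i} d∣i = ∣-Fold d⊥2 d∣B (fold-view (odd i)) (∣-iterate-t d⊥2 d∣B k d∣i)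

  -- `long` says that 2 has order at least n modulo odd n up to sign.
  module FullPeriod (0<n : 0 < n) (long : ∀ m → 0 < m → iterate t 0 m ≡ 0 → n ≤ m) where

    e : ℕ → ℕ
    e = iterate t 0

    e-< : ∀ k → e k < n
    e-< = iterate-t-< 0<n

    -- Injectivity of `t` cancels the first `a` steps, leaving a return to 0 after `b ∸ a` steps.
    e-gap : ∀ {a b} → a < b → e a ≡ e b → n ≤ b ∸ a
    e-gap {a} {b} a<b eq = long (b ∸ a) (m<n⇒0<n∸m a<b) (iterate-t-injective a (begin
      iterate t (e (b ∸ a)) a ≡⟨ iterate-+ t 0 (b ∸ a) a ⟨
      e (b ∸ a + a)           ≡⟨ cong e (m∸n+n≡m (<⇒≤ a<b)) ⟩
      e b                     ≡⟨ eq ⟨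
      e a                     ∎))
      where open ≡-Reasoning

    e-injective : ∀ {a b} → a < n → b < n → e a ≡ e b → a ≡ b
    e-injective {a} {b} a<n b<n eq with <-cmp a b
    ... | tri< a<b _ _ = contradiction (≤-trans (e-gap a<b eq) (m∸n≤m b a)) (<⇒≱ b<n)
    ... | tri≈ _ a≡b _ = a≡b
    ... | tri> _ _ b<a = contradiction (≤-trans (e-gap b<a (sym eq)) (m∸n≤m a b)) (<⇒≱ a<n)

    -- Pigeonhole on the n + 1 values `x`, `e 0`, ..., `e (n − 1)` below n. By `e-gap` no two of the
    -- latter collide, so `x` is one of them.
    e-surjective : ∀ {x} → x < n → ∃ λ k → k < n × e k ≡ x
    e-surjective {x} x<n with Fin.pigeonhole (n<1+n n) choose
      where
      choose : Fin (suc n) → Fin n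
      choose zero    = fromℕ< x<n
      choose (suc k) = fromℕ< (e-< (toℕ k))
    ... | zero  , suc k , _   , eq = toℕ k , Fin.toℕ<n k , sym (Fin.fromℕ<-injective _ _ _ _ eq)
    ... | suc i , suc j , i<j , eq = contradiction
      (≤-trans (e-gap (s<s⁻¹ i<j) (Fin.fromℕ<-injective _ _ _ _ eq)) (m∸n≤m (toℕ j) (toℕ i)))
      (<⇒≱ (Fin.toℕ<n j))

    e-n : e n ≡ 0
    e-n with e-surjective (e-< n)
    ... | zero  , _   , eq = sym eq
    ... | suc k , k<n , eq = contradiction (e-gap k<n eq) (<⇒≱ (∸-monoʳ-< z<s (<⇒≤ k<n)))

    -- A proper divisor of `odd n` is itself an odd number below it, hence lies on the orbit of 1.
    -- Pulled back along the orbit, it divides 1.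
    odd-n-prime : Prime (odd n)
    odd-n-prime = prime ⦃ nontrivial n 0<n ⦄ notComposite
      where
      nontrivial : ∀ n → 0 < n → NonTrivial (odd n)
      nontrivial (suc n) _ = _
      notComposite : ¬ Composite (odd n)
      notComposite (composite {d} d<B d∣B) with even-or-odd d
      ... | inj₁ (i , refl) = contradiction (coprime-odd-2 n
              (∣-trans 2∣d d∣B , ∣-refl)) λ ()
        where 2∣d = subst (2 ∣_) (2*-double i) (m∣m*n i)
      ... | inj₂ (i , refl) with e-surjective {i} (odd-cancel-< d<B)
      ...   | k , _ , eq = contradiction
              (∣1⇒≡1 (∣-iterate-t (coprime-odd-2 i) d∣B k (∣-reflexive (cong odd (sym eq)))))
              nonTrivial⇒≢1

-- Digits of the image of a string

module _ (B : ℕ) .{{_ : NonZero B}} where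

  open SortingAlgorithm (insertionSort (Fin.≤-decTotalOrder B)) using (sort; sort-↭; sort-↗)
  open Sorted (Fin.≤-totalOrder B) using (Sorted)

  sort-unique : ∀ {xs ys : List (Digit B)} → xs ↭ ys → Sorted ys → sort xs ≡ ys
  sort-unique {xs} {ys} xs↭ys ys↗ =
    Pointwise-≡⇒≡ (↗↭↗⇒≋ (Fin.≤-totalOrder B) (sort-↗ xs) ys↗ (↭⇒↭ₛ (↭-trans (sort-↭ xs) xs↭ys)))

  word : ℕ → ℕ → ℕ → ℕ → DigitString B
  word p q r s = (p mod B) ∷ (q mod B) ∷ (r mod B) ∷ (s mod B) ∷ []

  toℕ-mod : ∀ {m} → m < B → toℕ (m mod B) ≡ m
  toℕ-mod {m} m<B = trans (Fin.toℕ-fromℕ< (m%n<n m B)) (m<n⇒m%n≡m m<B)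

  mod-injective : ∀ {m k} → m < B → k < B → m mod B ≡ k mod B → m ≡ k
  mod-injective m<B k<B eq = trans (sym (toℕ-mod m<B)) (trans (cong toℕ eq) (toℕ-mod k<B))

  drop-digit : ∀ {s} v → s < B → (s + v * B) / B ≡ v
  drop-digit {s} v s<B = begin
    (s + v * B) / B     ≡⟨ +-distrib-/ s (v * B) (subst (_< B) (sym eq) (m%n<n s B)) ⟩
    s / B + v * B / B   ≡⟨ cong₂ _+_ (m<n⇒m/n≡0 s<B) (m*n/n≡m v B) ⟩
    v                   ∎
    where
    open ≡-Reasoning
    eq : s % B + v * B % B ≡ s % B
    eq = trans (cong (λ k → s % B + k) (m*n%n≡0 v B)) (+-identityʳ (s % B))

  fourDigits-value : ∀ {p q r s} → q < B → r < B → s < B →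
                     fourDigits B (s + (r + (q + p * B) * B) * B) ≡ word p q r s
  fourDigits-value {p} {q} {r} {s} q<B r<B s<B
    rewrite drop-digit (r + (q + p * B) * B) s<B | drop-digit (q + p * B) r<B | drop-digit p q<B =
    cong₂ (λ u v → (p mod B) ∷ u ∷ v) (low-digit q<B p)
      (cong₂ (λ u v → u ∷ v ∷ []) (low-digit r<B (q + p * B)) (low-digit s<B (r + (q + p * B) * B)))
    where
    low-digit : ∀ {s} → s < B → ∀ v → (s + v * B) mod B ≡ s mod B
    low-digit {s} s<B v = Fin.toℕ-injective (begin
      toℕ ((s + v * B) mod B) ≡⟨ Fin.toℕ-fromℕ< _ ⟩
      (s + v * B) % B         ≡⟨ [m+kn]%n≡m%n s v B ⟩
      s % B                   ≡⟨ Fin.toℕ-fromℕ< _ ⟨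
      toℕ (s mod B)           ∎)
      where open ≡-Reasoning

  -- x = a₁ − a₄ and y = a₂ − a₃, with the digits a ≤ b ≤ c ≤ d standing for a₄ ≤ a₃ ≤ a₂ ≤ a₁.
  record Spread (s : DigitString B) (x y : ℕ) : Set where
    constructor spread
    field
      {a b c d} : Digit B
      perm : toList s ↭ a ∷ b ∷ c ∷ d ∷ []
      a≤b : toℕ a ≤ toℕ b
      b≤c : toℕ b ≤ toℕ c
      c≤d : toℕ c ≤ toℕ d
      outer : toℕ a + x ≡ toℕ d
      inner : toℕ b + y ≡ toℕ c

  Spread-exists : ∀ s → ∃₂ (Spread s)
  Spread-exists s@(_ ∷ _ ∷ _ ∷ _ ∷ []) with sort (toList s) | sort-↭ (toList s) | sort-↗ (toList s)
  ... | _ ∷ _ ∷ _ ∷ _ ∷ [] | perm | a≤b ∷ b≤c ∷ c≤d ∷ [-] = _ , _ ,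
    spread (↭-sym perm) a≤b b≤c c≤d (m+[n∸m]≡n (≤-trans a≤b (≤-trans b≤c c≤d))) (m+[n∸m]≡n b≤c)
  ... | []                      | perm | _ = contradiction (↭-length perm) λ ()
  ... | _ ∷ []                  | perm | _ = contradiction (↭-length perm) λ ()
  ... | _ ∷ _ ∷ []              | perm | _ = contradiction (↭-length perm) λ ()
  ... | _ ∷ _ ∷ _ ∷ []          | perm | _ = contradiction (↭-length perm) λ ()
  ... | _ ∷ _ ∷ _ ∷ _ ∷ _ ∷ _   | perm | _ = contradiction (↭-length perm) λ ()

  Spread-x<B : ∀ {s x y} → Spread s x y → x < B
  Spread-x<B σ = ≤-<-trans (subst (_ ≤_) outer (m≤n+m _ _)) (Fin.toℕ<n d)
    where open Spread σ

  Spread-y≤x : ∀ {s x y} → Spread s x y → y ≤ x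
  Spread-y≤x {_} {x} {y} σ = +-cancelˡ-≤ (toℕ b) y x (begin
    toℕ b + y ≡⟨ inner ⟩
    toℕ c     ≤⟨ c≤d ⟩
    toℕ d     ≡⟨ outer ⟨
    toℕ a + x ≤⟨ +-monoˡ-≤ x a≤b ⟩
    toℕ b + x ∎)
    where
    open ≤-Reasoning
    open Spread σ

  Spread-constant : ∀ {s y} → Spread s 0 y → Constant s
  Spread-constant {_ ∷ _ ∷ _ ∷ _ ∷ []} σ = a , all-equal (All-resp-↭ (↭-sym perm)
    (refl ∷ collapse a≤b (≤-trans b≤c c≤d) ∷ collapse (≤-trans a≤b b≤c) c≤d
          ∷ collapse (≤-trans a≤b (≤-trans b≤c c≤d)) ≤-refl ∷ []))
    where
    open Spread σ
    collapse : ∀ {e} → toℕ a ≤ toℕ e → toℕ e ≤ toℕ d → e ≡ a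
    collapse {e} a≤e e≤d =
      Fin.toℕ-injective (≤-antisym (subst (toℕ e ≤_) (trans (sym outer) (+-identityʳ _)) e≤d) a≤e)
    all-equal : ∀ {p q r s : Digit B} → All (_≡ a) (p ∷ q ∷ r ∷ s ∷ []) → p ∷ q ∷ r ∷ s ∷ [] ≡ replicate 4 a
    all-equal (refl ∷ refl ∷ refl ∷ refl ∷ []) = refl

  Spread-word : ∀ {p q r s a b c d x y} → p ∷ q ∷ r ∷ s ∷ [] ↭ a ∷ b ∷ c ∷ d ∷ [] →
                a ≤ b → b ≤ c → c ≤ d → d < B → a + x ≡ d → b + y ≡ c → Spread (word p q r s) x y
  Spread-word {a = a} {b} {c} {d} {x} {y} perm a≤b b≤c c≤d d<B outer inner =
    spread (map⁺ (_mod B) perm)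
      (subst₂ _≤_ (sym a′) (sym b′) a≤b) (subst₂ _≤_ (sym b′) (sym c′) b≤c) (subst₂ _≤_ (sym c′) (sym d′) c≤d)
      (subst₂ (λ u v → u + x ≡ v) (sym a′) (sym d′) outer) (subst₂ (λ u v → u + y ≡ v) (sym b′) (sym c′) inner)
    where
    d′ = toℕ-mod d<B
    c′ = toℕ-mod (≤-<-trans c≤d d<B)
    b′ = toℕ-mod (≤-<-trans b≤c (≤-<-trans c≤d d<B))
    a′ = toℕ-mod (≤-<-trans a≤b (≤-<-trans b≤c (≤-<-trans c≤d d<B)))

  -- The difference enters as a summand `m`, so that later digit computations are additions with
  -- carries and involve no truncated subtraction of the two numbers.
  kaprekar-difference : ∀ {s x y} (σ : Spread s x y) → let open Spread σ in
    ∀ m → m + fromDigits (d ∷ c ∷ b ∷ a ∷ []) ≡ fromDigits (a ∷ b ∷ c ∷ d ∷ []) →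
    kaprekar B s ≡ fourDigits B m
  kaprekar-difference {s} σ m eq = cong (fourDigits B) (begin
    fromDigits (sort (toList s)) ∸ fromDigits (List.reverse (sort (toList s)))
      ≡⟨ cong (λ ds → fromDigits ds ∸ fromDigits (List.reverse ds)) (sort-unique perm (a≤b ∷ b≤c ∷ c≤d ∷ [-])) ⟩
    fromDigits (a ∷ b ∷ c ∷ d ∷ []) ∸ fromDigits (d ∷ c ∷ b ∷ a ∷ [])
      ≡⟨ cong (λ k → k ∸ fromDigits (d ∷ c ∷ b ∷ a ∷ [])) eq ⟨
    m + fromDigits (d ∷ c ∷ b ∷ a ∷ []) ∸ fromDigits (d ∷ c ∷ b ∷ a ∷ [])
      ≡⟨ m+n∸n≡m m (fromDigits (d ∷ c ∷ b ∷ a ∷ [])) ⟩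
    m ∎)
    where
    open ≡-Reasoning
    open Spread σ

  -- Correct only for y > 0; for y = 0 the borrows differ, as in `kaprekar-zero`.
  image : ℕ → ℕ → DigitString B
  image x y = word x (pred y) (B ∸ suc y) (B ∸ x)

  -- With inner difference v = `suc y`, the value is xB³ + vB² - vB - x, with digits x, v - 1, B - 1
  -- - v, B - x. Adding the reversed number back carries out of the two lowest places only; each
  -- `cong` step below performs one carry.
  kaprekar-suc : ∀ {s x y} → Spread s x (suc y) → kaprekar B s ≡ image x (suc y)
  kaprekar-suc {s} {x} {y} σ =
    trans (kaprekar-difference σ (w + (z + (y + x * B) * B) * B) difference)
      (fourDigits-value (<-trans (n<1+n y) y<B) (∸-monoʳ-< z<s y<B) (∸-monoʳ-< x>0 (<⇒≤ x<B)))
    where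
    open Spread σ
    open ≡-Reasoning
    w = B ∸ x
    z = B ∸ suc (suc y)
    x<B = Spread-x<B σ
    y<B = ≤-<-trans (Spread-y≤x σ) x<B
    x>0 = ≤-trans z<s (Spread-y≤x σ)
    outer-complement : w + x ≡ B
    outer-complement = m∸n+n≡m (<⇒≤ x<B)
    inner-complement : z + suc (suc y) ≡ B
    inner-complement = m∸n+n≡m y<B
    expand : ∀ w z y x a b B →
      w + (z + (y + x * B) * B) * B + (a + x + (b + suc y + (b + (a + 0 * B) * B) * B) * B)
        ≡ a + (w + x) + (b + (z + suc y) + (b + y + (a + x + 0 * B) * B) * B) * B
    expand = solve-∀
    contract : ∀ a b c y x B →
      a + B + (b + c + (b + y + (a + x + 0 * B) * B) * B) * B
        ≡ a + (b + (suc c) + (b + y + (a + x + 0 * B) * B) * B) * B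
    contract = solve-∀
    contract′ : ∀ a b y x B →
      a + (b + B + (b + y + (a + x + 0 * B) * B) * B) * B
        ≡ a + (b + (b + suc y + (a + x + 0 * B) * B) * B) * B
    contract′ = solve-∀
    difference : w + (z + (y + x * B) * B) * B + fromDigits (d ∷ c ∷ b ∷ a ∷ [])
               ≡ fromDigits (a ∷ b ∷ c ∷ d ∷ [])
    difference rewrite sym outer | sym inner = begin
      _ ≡⟨ expand w z y x (toℕ a) (toℕ b) B ⟩
      _ ≡⟨ cong (λ k → toℕ a + k + (toℕ b + (z + suc y) + (toℕ b + y + (toℕ a + x + 0 * B) * B) * B) * B) outer-complement ⟩
      _ ≡⟨ contract (toℕ a) (toℕ b) (z + suc y) y x B ⟩
      _ ≡⟨ cong (λ k → toℕ a + (toℕ b + k + (toℕ b + y + (toℕ a + x + 0 * B) * B) * B) * B)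
             (trans (sym (+-suc z (suc y))) inner-complement) ⟩
      _ ≡⟨ contract′ (toℕ a) (toℕ b) y x B ⟩
      _ ∎

  -- Now the value is (x + 1)(B³ - 1), and the borrow runs through both middle places, turning them
  -- into B - 1. Checking it takes three carries.
  kaprekar-zero : ∀ {s x} → Spread s (suc x) 0 → kaprekar B s ≡ word x (pred B) (pred B) (B ∸ suc x)
  kaprekar-zero {s} {x} σ =
    trans (kaprekar-difference σ (w + (z + (z + x * B) * B) * B) difference)
      (fourDigits-value z<B z<B (∸-monoʳ-< z<s (<⇒≤ x<B)))
    where
    open Spread σ
    open ≡-Reasoning
    w = B ∸ suc x
    z = pred B
    x<B = Spread-x<B σ
    outer-complement : w + suc x ≡ B
    outer-complement = m∸n+n≡m (<⇒≤ x<B)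
    suc-z : suc z ≡ B
    suc-z = suc-pred B
    z<B = ≤-reflexive suc-z
    expand : ∀ w z x a b B →
      w + (z + (z + x * B) * B) * B + (a + suc x + (b + 0 + (b + (a + 0 * B) * B) * B) * B)
        ≡ a + (w + suc x) + (b + z + (b + z + (a + x + 0 * B) * B) * B) * B
    expand = solve-∀
    contract : ∀ a b z x B →
      a + B + (b + z + (b + z + (a + x + 0 * B) * B) * B) * B
        ≡ a + (b + suc z + (b + z + (a + x + 0 * B) * B) * B) * B
    contract = solve-∀
    contract′ : ∀ a b z x B →
      a + (b + B + (b + z + (a + x + 0 * B) * B) * B) * B
        ≡ a + (b + (b + suc z + (a + x + 0 * B) * B) * B) * B
    contract′ = solve-∀
    contract″ : ∀ a b x B →
      a + (b + (b + B + (a + x + 0 * B) * B) * B) * B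
        ≡ a + (b + (b + 0 + (a + suc x + 0 * B) * B) * B) * B
    contract″ = solve-∀
    difference : w + (z + (z + x * B) * B) * B + fromDigits (d ∷ c ∷ b ∷ a ∷ [])
               ≡ fromDigits (a ∷ b ∷ c ∷ d ∷ [])
    difference rewrite sym outer | sym inner = begin
      _ ≡⟨ expand w z x (toℕ a) (toℕ b) B ⟩
      _ ≡⟨ cong (λ k → toℕ a + k + (toℕ b + z + (toℕ b + z + (toℕ a + x + 0 * B) * B) * B) * B) outer-complement ⟩
      _ ≡⟨ contract (toℕ a) (toℕ b) z x B ⟩
      _ ≡⟨ cong (λ k → toℕ a + (toℕ b + k + (toℕ b + z + (toℕ a + x + 0 * B) * B) * B) * B) suc-z ⟩
      _ ≡⟨ contract′ (toℕ a) (toℕ b) z x B ⟩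
      _ ≡⟨ cong (λ k → toℕ a + (toℕ b + (toℕ b + k + (toℕ a + x + 0 * B) * B) * B) * B) suc-z ⟩
      _ ≡⟨ contract″ (toℕ a) (toℕ b) x B ⟩
      _ ∎

-- The Kaprekar map in an odd base as doubling of pairs

+≡⇒∸≡ : ∀ {m k l} → m + k ≡ l → l ∸ m ≡ k
+≡⇒∸≡ {m} {k} refl = m+n∸m≡n m k

⊔-⊓-injective : ∀ {i j k l} → i ⊔ j ≡ k ⊔ l → i ⊓ j ≡ k ⊓ l → (i ≡ k × j ≡ l) ⊎ (i ≡ l × j ≡ k)
⊔-⊓-injective {i} {j} {k} {l} eq⊔ eq⊓ with ≤-total i j | ≤-total k l
... | inj₁ i≤j | inj₁ k≤l rewrite m≤n⇒m⊔n≡n i≤j | m≤n⇒m⊔n≡n k≤l | m≤n⇒m⊓n≡m i≤j | m≤n⇒m⊓n≡m k≤l = inj₁ (eq⊓ , eq⊔)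
... | inj₁ i≤j | inj₂ l≤k rewrite m≤n⇒m⊔n≡n i≤j | m≥n⇒m⊔n≡m l≤k | m≤n⇒m⊓n≡m i≤j | m≥n⇒m⊓n≡n l≤k = inj₂ (eq⊓ , eq⊔)
... | inj₂ j≤i | inj₁ k≤l rewrite m≥n⇒m⊔n≡m j≤i | m≤n⇒m⊔n≡n k≤l | m≥n⇒m⊓n≡n j≤i | m≤n⇒m⊓n≡m k≤l = inj₂ (eq⊔ , eq⊓)
... | inj₂ j≤i | inj₂ l≤k rewrite m≥n⇒m⊔n≡m j≤i | m≥n⇒m⊔n≡m l≤k | m≥n⇒m⊓n≡n j≤i | m≥n⇒m⊓n≡n l≤k = inj₁ (eq⊔ , eq⊓)

module OddBase (n : ℕ) where

  open Doubling n

  B : ℕ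
  B = odd n

  K : DigitString B → DigitString B
  K = kaprekar B

  -- The successor of every string whose differences are `odd i` and `odd j` in either order; `⊔`
  -- and `⊓` make it depend on the unordered pair only.
  Str : ℕ → ℕ → DigitString B
  Str i j = image B (odd (i ⊔ j)) (odd (i ⊓ j))

  Str-comm : ∀ i j → Str i j ≡ Str j i
  Str-comm i j = cong₂ (λ u v → image B (odd u) (odd v)) (⊔-comm i j) (⊓-comm i j)

  -- The first two digits are the larger odd number and the smaller one minus 1.
  Str-injective : ∀ {i j k l} → i < n → j < n → k < n → l < n → Str i j ≡ Str k l →
                  (i ≡ k × j ≡ l) ⊎ (i ≡ l × j ≡ k)
  Str-injective i<n j<n k<n l<n eq = ⊔-⊓-injective
    (odd-injective (mod-injective B (odd-mono-< (⊔-lub i<n j<n)) (odd-mono-< (⊔-lub k<n l<n))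
      (proj₁ (∷-injective eq))))
    (odd-injective (cong suc (mod-injective B (<-trans (n<1+n _) (odd-mono-< (m<n⇒m⊓o<n _ i<n)))
      (<-trans (n<1+n _) (odd-mono-< (m<n⇒m⊓o<n _ k<n)))
      (proj₁ (∷-injective (proj₂ (∷-injective eq)))))))

  -- Equality of the first digit x and the last digit B - x would make B even.
  Str-nonconstant : ∀ {i j} → i < n → j < n → ¬ Constant (Str i j)
  Str-nonconstant {i} {j} i<n j<n (d , eq) = double≢odd x n (begin
    x + x       ≡⟨ cong (λ k → x + k) first≡last ⟩
    x + (B ∸ x) ≡⟨ m+[n∸m]≡n (<⇒≤ x<B) ⟩
    B           ∎)
    where
    open ≡-Reasoning
    x = odd (i ⊔ j)
    x<B : x < B
    x<B = odd-mono-< (⊔-lub i<n j<n)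
    first≡last : x ≡ B ∸ x
    first≡last with eq₁ , eq′ ← ∷-injective eq with _ , eq″ ← ∷-injective eq′ with _ , eq‴ ← ∷-injective eq″ =
      mod-injective B x<B (∸-monoʳ-< z<s (<⇒≤ x<B)) (trans eq₁ (sym (proj₁ (∷-injective eq‴))))

  Spread⇒Str : ∀ {s} i j → Spread B s (odd (i ⊔ j)) (odd (i ⊓ j)) → K s ≡ Str i j
  Spread⇒Str i j σ = kaprekar-suc B σ

  outer-digits : ∀ {x i} → Fold x i → x ∷ B ∸ x ∷ [] ↭ n ∸ i ∷ suc (n + i) ∷ []
  outer-digits {x} {i} (low refl) = ↭-reflexive (cong₂ (λ u v → u ∷ v ∷ [])
    (sym (m+n∸n≡m x i)) (+≡⇒∸≡ (identity x i)))
    where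
    identity : ∀ x i → x + suc (x + i + i) ≡ suc (x + i + (x + i))
    identity = solve-∀
  outer-digits {x} {i} (high refl) rewrite [m+n]∸[m+o]≡n∸o n n i = swap _ _ ↭-refl

  inner-digits : ∀ {y j} → Fold (suc y) j → y ∷ B ∸ suc (suc y) ∷ [] ↭ n ∸ suc j ∷ n + j ∷ []
  inner-digits {y} {j} (low refl) = ↭-reflexive (cong₂ (λ u v → u ∷ v ∷ [])
    (sym (m+n∸n≡m y j)) (+≡⇒∸≡ {suc y} (identity y j)))
    where
    identity : ∀ y j → suc y + (suc y + j + j) ≡ suc y + j + (suc y + j)
    identity = solve-∀
  inner-digits {y} {j} (high refl) = ↭-trans (swap _ _ ↭-refl) (↭-reflexive
    (cong (λ u → u ∷ n + j ∷ []) (trans (cong (λ k → n + n ∸ k) (sym (+-suc n j))) ([m+n]∸[m+o]≡n∸o n n (suc j)))))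

  -- The four digits form two pairs: one with sum 2n + 1 and difference `odd i`, one with sum 2n - 1
  -- and difference `odd j`. For distinct indices one pair encloses the other, so these are again
  -- the two differences; for equal indices the pairs interleave, giving 2i + 2 and 2i.
  image-digits : ∀ {x y i j} → Fold x i → Fold (suc y) j →
    x ∷ y ∷ B ∸ suc (suc y) ∷ B ∸ x ∷ [] ↭ n ∸ i ∷ suc (n + i) ∷ n ∸ suc j ∷ n + j ∷ []
  image-digits fx fy = ↭-trans
    (prep _ (↭-trans (prep _ (swap _ _ ↭-refl)) (swap _ _ ↭-refl)))
    (++⁺ (outer-digits fx) (inner-digits fy))

  n∸m+odd : ∀ {m} → m < n → n ∸ m + odd m ≡ suc (n + m)
  n∸m+odd {m} m<n = begin
    n ∸ m + odd m         ≡⟨ +-suc (n ∸ m) (m + m) ⟩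
    suc (n ∸ m + (m + m)) ≡⟨ cong suc (+-assoc (n ∸ m) m m) ⟨
    suc (n ∸ m + m + m)   ≡⟨ cong (λ k → suc (k + m)) (m∸n+n≡m (<⇒≤ m<n)) ⟩
    suc (n + m)           ∎
    where open ≡-Reasoning

  n∸suc-m+odd : ∀ {m} → m < n → n ∸ suc m + odd m ≡ n + m
  n∸suc-m+odd {m} m<n = begin
    n ∸ suc m + (suc m + m) ≡⟨ +-assoc (n ∸ suc m) (suc m) m ⟨
    n ∸ suc m + suc m + m   ≡⟨ cong (_+ m) (m∸n+n≡m m<n) ⟩
    n + m                   ∎
    where open ≡-Reasoning

  module _ {x y i j : ℕ} (i<n : i < n) (j<n : j < n) (fx : Fold x i) (fy : Fold (suc y) j) where

    private
      digits = image-digits fx fy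

    Spread-image-> : j < i → Spread B (image B x (suc y)) (odd i) (odd j)
    Spread-image-> j<i = Spread-word B (↭-trans digits (prep _ (↭-trans (swap _ _ ↭-refl) (prep _ (swap _ _ ↭-refl)))))
      (∸-monoʳ-≤ n j<i) (≤-trans (m∸n≤m n (suc j)) (m≤m+n n j)) (m≤n⇒m≤1+n (+-monoʳ-≤ n (<⇒≤ j<i)))
      (s<s (+-monoʳ-< n i<n)) (n∸m+odd i<n) (n∸suc-m+odd j<n)

    Spread-image-< : i < j → Spread B (image B x (suc y)) (odd j) (odd i)
    Spread-image-< i<j = Spread-word B (↭-trans digits (↭-trans (prep _ (swap _ _ ↭-refl)) (swap _ _ ↭-refl)))
      (∸-monoʳ-≤ n (m≤n⇒m≤1+n (<⇒≤ i<j))) (≤-trans (m∸n≤m n i) (m≤n⇒m≤1+n (m≤m+n n i)))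
      (subst (_≤ n + j) (+-suc n i) (+-monoʳ-≤ n i<j))
      (m<n⇒m<1+n (+-monoʳ-< n j<n)) (n∸suc-m+odd j<n) (n∸m+odd i<n)

    Spread-image-≢ : i ≢ j → Spread B (image B x (suc y)) (odd (i ⊔ j)) (odd (i ⊓ j))
    Spread-image-≢ i≢j with <-cmp i j
    ... | tri< i<j _ _ rewrite m≤n⇒m⊔n≡n (<⇒≤ i<j) | m≤n⇒m⊓n≡m (<⇒≤ i<j) = Spread-image-< i<j
    ... | tri≈ _ i≡j _ = contradiction i≡j i≢j
    ... | tri> _ _ j<i rewrite m≥n⇒m⊔n≡m (<⇒≤ j<i) | m≥n⇒m⊓n≡n (<⇒≤ j<i) = Spread-image-> j<i

    Spread-image-≡ : i ≡ j → Spread B (image B x (suc y)) (suc (odd i)) (i + i)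
    Spread-image-≡ refl = Spread-word B
      (↭-trans digits (↭-trans (prep _ (swap _ _ ↭-refl)) (↭-trans (swap _ _ ↭-refl) (prep _ (prep _ (swap _ _ ↭-refl))))))
      (∸-monoʳ-≤ n (n≤1+n i)) (≤-trans (m∸n≤m n i) (m≤m+n n i)) (n≤1+n (n + i))
      (s<s (+-monoʳ-< n i<n)) (trans (+-suc (n ∸ suc i) (odd i)) (cong suc (n∸suc-m+odd i<n)))
      (suc-injective (trans (sym (+-suc (n ∸ i) (i + i))) (n∸m+odd i<n)))

  K-Str : ∀ {i j} → i < n → j < n → i ≢ j → K (Str i j) ≡ Str (t i) (t j)
  K-Str {i} {j} i<n j<n i≢j with <-cmp i j
  ... | tri≈ _ i≡j _ = contradiction i≡j i≢j
  ... | tri> _ _ j<i rewrite m≥n⇒m⊔n≡m (<⇒≤ j<i) | m≥n⇒m⊓n≡n (<⇒≤ j<i) =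
    Spread⇒Str (t i) (t j) (Spread-image-≢ (t-< i<n) (t-< j<n) (fold-view (odd i)) (fold-view (odd j)) (λ eq → i≢j (t-injective eq)))
  ... | tri< i<j _ _ rewrite m≤n⇒m⊔n≡n (<⇒≤ i<j) | m≤n⇒m⊓n≡m (<⇒≤ i<j) = trans
    (Spread⇒Str (t j) (t i) (Spread-image-≢ (t-< j<n) (t-< i<n) (fold-view (odd j)) (fold-view (odd i)) (λ eq → i≢j (sym (t-injective eq)))))
    (Str-comm (t j) (t i))

  iterate-K-Str : ∀ k {i j} → i < n → j < n → i ≢ j → iterate K (Str i j) k ≡ Str (iterate t i k) (iterate t j k)
  iterate-K-Str zero    i<n j<n i≢j = refl
  iterate-K-Str (suc k) i<n j<n i≢j = trans (cong (λ s → iterate K s k) (K-Str i<n j<n i≢j))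
    (iterate-K-Str k (t-< i<n) (t-< j<n) (λ eq → i≢j (t-injective eq)))

  -- Every nonconstant string reaches a pair of distinct odd differences

  Spread-resp : ∀ {s s′ x y} → s ≡ s′ → Spread B s x y → Spread B s′ x y
  Spread-resp refl σ = σ

  record Reaches (s : DigitString B) : Set where
    constructor reaches
    field
      {i j} : ℕ
      steps : ℕ
      i<n   : i < n
      j<n   : j < n
      i≢j   : i ≢ j
      eq    : iterate K s steps ≡ Str i j

  Reaches-K : ∀ {s} → Reaches (K s) → Reaches s
  Reaches-K (reaches k i<n j<n i≢j eq) = reaches (suc k) i<n j<n i≢j eq

  reaches-odd : ∀ {s i j} → Spread B s (odd (i ⊔ j)) (odd (i ⊓ j)) → i < n → j < n → i ≢ j → Reaches s
  reaches-odd {_} {i} {j} σ i<n j<n i≢j = reaches 1 i<n j<n i≢j (Spread⇒Str i j σ)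

  module _ {s x y} (σ : Spread B s x (suc y)) where

    private
      x<B : x < B
      x<B = Spread-x<B B σ
      y≤x : suc y ≤ x
      y≤x = Spread-y≤x B σ
      i<n : fold x < n
      i<n = Fold-< (≤-trans z<s y≤x) x<B (fold-view x)
      j<n : fold (suc y) < n
      j<n = Fold-< z<s (≤-<-trans y≤x x<B) (fold-view (suc y))

    Spread-K-≢ : fold x ≢ fold (suc y) → Spread B (K s) (odd (fold x ⊔ fold (suc y))) (odd (fold x ⊓ fold (suc y)))
    Spread-K-≢ i≢j = Spread-resp (sym (kaprekar-suc B σ))
      (Spread-image-≢ i<n j<n (fold-view x) (fold-view (suc y)) i≢j)

    Spread-K-≡ : fold x ≡ fold (suc y) → Spread B (K s) (suc (odd (fold x))) (fold x + fold x)
    Spread-K-≡ i≡j = Spread-resp (sym (kaprekar-suc B σ))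
      (Spread-image-≡ i<n j<n (fold-view x) (fold-view (suc y)) i≡j)

    reaches-≢ : fold x ≢ fold (suc y) → Reaches s
    reaches-≢ i≢j = Reaches-K (reaches-odd (Spread-K-≢ i≢j) i<n j<n i≢j)

  -- The digits are x, 2n, 2n and w = 2n - x. Subtracting x and w from the two largest digits 2n
  -- merely exchanges them.
  Spread-K-zero : ∀ {s x w} → x + w ≡ n + n → Spread B s (suc x) 0 → Spread B (K s) (x ⊔ w) (x ⊓ w)
  Spread-K-zero {s} {x} {w} eq σ = Spread-resp
    (sym (trans (kaprekar-zero B σ) (cong (word B x (n + n) (n + n)) (+≡⇒∸≡ {x} eq))))
    spread-word
    where
    x≤2n : x ≤ n + n
    x≤2n = subst (x ≤_) eq (m≤m+n x w)
    w≤2n : w ≤ n + n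
    w≤2n = subst (w ≤_) eq (m≤n+m w x)
    spread-word : Spread B (word B x (n + n) (n + n) w) (x ⊔ w) (x ⊓ w)
    spread-word with ≤-total x w
    ... | inj₁ x≤w rewrite m≤n⇒m⊔n≡n x≤w | m≤n⇒m⊓n≡m x≤w =
      Spread-word B (prep _ (↭-trans (prep _ (swap _ _ ↭-refl)) (swap _ _ ↭-refl)))
        x≤w w≤2n ≤-refl ≤-refl eq (trans (+-comm w x) eq)
    ... | inj₂ w≤x rewrite m≥n⇒m⊔n≡m w≤x | m≥n⇒m⊓n≡n w≤x =
      Spread-word B (↭-trans (prep _ (↭-trans (prep _ (swap _ _ ↭-refl)) (swap _ _ ↭-refl))) (swap _ _ ↭-refl))
        w≤x x≤2n ≤-refl ≤-refl (trans (+-comm w x) eq) eq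

  module _ {m} (n≡1+m : n ≡ suc m) (0<m : 0 < m) where

    private
      m<n : m < n
      m<n = ≤-reflexive (sym n≡1+m)
      0<n : 0 < n
      0<n = <-trans 0<m m<n
      1+odd-m : suc (odd m) ≡ n + n
      1+odd-m = trans (cong suc (sym (+-suc m m))) (cong₂ _+_ (sym n≡1+m) (sym n≡1+m))

    -- The differences 2, 0 and 2n, 0 both lead to 2n - 1 and 1, that is, to the indices m and 0,
    -- which are distinct because B > 3.
    reaches-2-0 : ∀ {s} → Spread B s 2 0 → Reaches s
    reaches-2-0 σ = Reaches-K (reaches-odd (Spread-K-zero {w = odd m} 1+odd-m σ) 0<n m<n (<⇒≢ 0<m))

    reaches-2n-0 : ∀ {s} → Spread B s (n + n) 0 → Reaches s
    reaches-2n-0 {s} σ = Reaches-K (reaches-odd {i = 0} {m}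
      (subst₂ (Spread B (K s)) (⊔-comm (odd m) 1) (⊓-comm (odd m) 1)
        (Spread-K-zero {x = odd m} {1} (trans (+-comm (odd m) 1) 1+odd-m)
          (subst (λ x → Spread B s x 0) (sym 1+odd-m) σ)))
      0<n m<n (<⇒≢ 0<m))

    reaches-suc : ∀ {s x y} → Spread B s x (suc y) → Reaches s
    reaches-suc {s} {x} {y} σ with fold x ≟ fold (suc y)
    ... | no  i≢j = reaches-≢ σ i≢j
    ... | yes i≡j = Reaches-K (continue (fold x) (Spread-K-≡ σ i≡j))
      where
      -- After a collision of folds the differences are 2i + 2 and 2i: unequal, and with an even
      -- sum, which is not B. Hence they do not collide again; i = 0 is the separate case 2, 0.
      distinct : ∀ i → fold (suc (odd i)) ≢ fold (i + i)
      distinct i eq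
        with Fold-injective (fold-view (suc (odd i))) (subst (Fold (i + i)) (sym eq) (fold-view (i + i)))
      ... | inj₁ p = contradiction (sym p) (<⇒≢ (m<n⇒m<1+n (n<1+n (i + i))))
      ... | inj₂ p = contradiction (trans (cong suc (+-suc (i + i) (i + i))) p) (double≢odd (odd i) n)
      continue : ∀ i → Spread B (K s) (suc (odd i)) (i + i) → Reaches (K s)
      continue zero    τ = reaches-2-0 τ
      continue (suc i) τ = reaches-≢ τ (distinct (suc i))

    reaches-zero : ∀ {s x} → Spread B s (suc x) 0 → Reaches s
    -- The differences 1, 0 become 2n, 0. A larger outer difference gives, next, two positive
    -- differences.
    reaches-zero {s} {zero}  σ = Reaches-K (reaches-2n-0 (Spread-K-zero refl σ))
    reaches-zero {s} {suc x} σ with n + n ∸ suc x in eq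
    ... | zero  = contradiction (m∸n≡0⇒m≤n eq) (<⇒≱ (s<s⁻¹ (Spread-x<B B σ)))
    ... | suc w = Reaches-K (reaches-suc (Spread-K-zero {w = suc w}
      (trans (cong (λ k → suc x + k) (sym eq)) (m+[n∸m]≡n (<⇒≤ (s<s⁻¹ (Spread-x<B B σ))))) σ))

    reaches-nonconstant : ∀ {s} → ¬ Constant s → Reaches s
    reaches-nonconstant {s} ¬const with Spread-exists B s
    ... | zero  , _     , σ = contradiction (Spread-constant B σ) ¬const
    ... | suc x , zero  , σ = reaches-zero σ
    ... | suc x , suc y , σ = reaches-suc σ

-- Cycles of length n

module Cycles (m : ℕ) (0<m : 0 < m) where

  private
    n : ℕ
    n = suc m

  open Doubling n
  open OddBase n
  open TerminalCycle

  record Normal (s : DigitString B) : Set where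
    constructor normal
    field
      {i j} : ℕ
      i<n   : i < n
      j<n   : j < n
      i≢j   : i ≢ j
      eq    : s ≡ Str i j

  -- The start reaches some `Str` after k steps, and completing k turns brings it back to the start
  -- through strings of the form `Str`.
  cycle-normal : ∀ γ → Normal (start γ)
  cycle-normal γ with reaches-nonconstant refl 0<m (nonconstant γ 0)
  ... | reaches {i} {j} k i<n j<n i≢j eq = normal (iterate-t-< i<n r) (iterate-t-< j<n r) (λ eq → i≢j (iterate-t-injective r eq))
    (begin
      start γ                         ≡⟨ iterate-return K (positive γ) (periodic γ) k ⟨
      iterate K (iterate K (start γ) k) r ≡⟨ cong (λ s → iterate K s r) eq ⟩
      iterate K (Str i j) r           ≡⟨ iterate-K-Str r i<n j<n i≢j ⟩
      Str (iterate t i r) (iterate t j r) ∎)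
    where
    open ≡-Reasoning
    r = k * length γ ∸ k

  -- If doubling returns 1 to itself after k steps, it returns every index, hence also the start of
  -- the cycle. So a long cycle forces a long orbit of 1.
  length≤period : ∀ γ k → 0 < k → iterate t 0 k ≡ 0 → length γ ≤ k
  length≤period γ k 0<k eq₀ with length γ ≤? k | cycle-normal γ
  ... | yes le | _ = le
  ... | no ¬le | normal {i} {j} i<n j<n i≢j eq = contradiction (begin
    iterate K (start γ) k               ≡⟨ cong (λ s → iterate K s k) eq ⟩
    iterate K (Str i j) k               ≡⟨ iterate-K-Str k i<n j<n i≢j ⟩
    Str (iterate t i k) (iterate t j k) ≡⟨ cong₂ Str (iterate-t-fixes k z<s eq₀ i<n) (iterate-t-fixes k z<s eq₀ j<n) ⟩
    Str i j                             ≡⟨ eq ⟨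
    start γ                             ∎) (minimal γ k 0<k (≰⇒> ¬le))
    where open ≡-Reasoning

  orbit-⊆ : ∀ γ δ c → iterate K (start γ) c ≡ start δ → ∀ {s} → orbit B δ s → orbit B γ s
  orbit-⊆ γ δ c eq (k , eq′) = c + k , trans (iterate-+ K (start γ) c k) (trans (cong (λ s → iterate K s k) eq) eq′)

  orbit-≐ : ∀ γ δ c → iterate K (start γ) c ≡ start δ →
            (∀ {s} → orbit B γ s → orbit B δ s) × (∀ {s} → orbit B δ s → orbit B γ s)
  orbit-≐ γ δ c eq =
    orbit-⊆ δ γ (c * length γ ∸ c) (trans (cong (λ s → iterate K s (c * length γ ∸ c)) (sym eq))
      (iterate-return K (positive γ) (periodic γ) c)) ,
    orbit-⊆ γ δ c eq

  -- Counting cycles by the gap along the orbit of 1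

  module Count (0-period : ∀ k → 0 < k → iterate t 0 k ≡ 0 → n ≤ k) where

    open FullPeriod z<s 0-period

    pair : ℕ → ℕ → DigitString B
    pair d a = Str (e a) (e (d + a))

    pair-wrap : ∀ d a → e (d + (n + a)) ≡ e (d + a)
    pair-wrap d a = begin
      e (d + (n + a))       ≡⟨ cong e (+-comm d (n + a)) ⟩
      e (n + a + d)         ≡⟨ cong e (+-assoc n a d) ⟩
      e (n + (a + d))       ≡⟨ iterate-+ t 0 n (a + d) ⟩
      iterate t (e n) (a + d) ≡⟨ cong (λ i → iterate t i (a + d)) e-n ⟩
      e (a + d)             ≡⟨ cong e (+-comm a d) ⟩
      e (d + a)             ∎
      where open ≡-Reasoning

    pair-period : ∀ d → pair d n ≡ pair d 0
    pair-period d = cong₂ Str e-n (trans (cong (λ k → e (d + k)) (sym (+-identityʳ n))) (pair-wrap d 0))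

    module _ {d} (0<d : 0 < d) (d+d<n : d + d < n) where

      private
        d<n : d < n
        d<n = ≤-<-trans (m≤m+n d d) d+d<n

      iterate-pair : ∀ k → iterate K (pair d 0) k ≡ pair d k
      iterate-pair k rewrite +-identityʳ d = trans
        (iterate-K-Str k z<s (e-< d) (λ eq → <⇒≢ 0<d (e-injective z<s d<n eq)))
        (cong (Str (e k)) (sym (iterate-+ t 0 d k)))

      -- If the points match in order, the gaps agree. If they match crosswise, d′ + d steps bring 1
      -- back to itself, though both gaps are below n / 2.
      pair-injective : ∀ {d′} → 0 < d′ → d′ + d′ < n → ∀ k → pair d k ≡ pair d′ 0 → d ≡ d′
      pair-injective {d′} 0<d′ d′+d′<n k eq
        with Str-injective (e-< k) (e-< (d + k)) (e-< 0) (e-< (d′ + 0)) eq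
      ... | inj₁ (p , q) = e-injective d<n (≤-<-trans (m≤m+n d′ d′) d′+d′<n) (begin
        e d               ≡⟨ cong (λ i → iterate t i d) p ⟨
        iterate t (e k) d ≡⟨ iterate-+ t 0 k d ⟨
        e (k + d)         ≡⟨ cong e (+-comm k d) ⟩
        e (d + k)         ≡⟨ q ⟩
        e (d′ + 0)        ≡⟨ cong e (+-identityʳ d′) ⟩
        e d′              ∎)
        where open ≡-Reasoning
      ... | inj₂ (p , q) = contradiction (e-gap {0} {d′ + d} (≤-trans 0<d′ (m≤m+n d′ d)) (sym (begin
        e (d′ + d)               ≡⟨ iterate-+ t 0 d′ d ⟩
        iterate t (e d′) d       ≡⟨ cong (λ i → iterate t i d) (trans (cong e (sym (+-identityʳ d′))) (sym p)) ⟩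
        iterate t (e k) d        ≡⟨ iterate-+ t 0 k d ⟨
        e (k + d)                ≡⟨ cong e (+-comm k d) ⟩
        e (d + k)                ≡⟨ q ⟩
        0                        ∎))) (<⇒≱ sum<n)
        where
        open ≡-Reasoning
        sum<n : d′ + d < n
        sum<n with ≤-total d d′
        ... | inj₁ d≤d′ = ≤-<-trans (+-monoʳ-≤ d′ d≤d′) d′+d′<n
        ... | inj₂ d′≤d = ≤-<-trans (+-monoˡ-≤ d d′≤d) d+d<n

      gap-cycle : TerminalCycle B
      gap-cycle = record
        { start       = pair d 0
        ; length      = n
        ; positive    = z<s
        ; periodic    = trans (iterate-pair n) (pair-period d)
        ; minimal     = minimal′
        ; nonconstant = λ k const → Str-nonconstant (e-< k) (e-< (d + k)) (subst Constant (iterate-pair k) const)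
        }
        where
        minimal′ : ∀ k → 0 < k → k < n → iterate K (pair d 0) k ≢ pair d 0
        minimal′ k 0<k k<n eq
          with Str-injective (e-< k) (e-< (d + k)) (e-< 0) (e-< (d + 0)) (trans (sym (iterate-pair k)) eq)
        ... | inj₁ (p , _) = <⇒≢ 0<k (sym (e-injective k<n z<s p))
        -- An early return with the points exchanged needs k = d and then `e (d + d)` = 0, which d +
        -- d < n excludes.
        ... | inj₂ (p , q) = <⇒≢ (≤-trans 0<d (m≤m+n d d)) (sym (e-injective d+d<n z<s (trans (cong (λ k → e (d + k)) (sym k≡d)) q)))
          where
          k≡d : k ≡ d
          k≡d = e-injective k<n d<n (trans p (cong e (+-identityʳ d)))

    -- A cycle through the pair of points e a and e (d + a) also passes through the pair with
    -- d replaced by n − d, so d < n / 2 can be arranged; d = n / 2 would halve the period.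
    record Gap (s : DigitString B) : Set where
      constructor gap
      field
        {d}   : ℕ
        0<d   : 0 < d
        d+d<n : d + d < n
        a     : ℕ
        eq    : s ≡ pair d a

    ordered-gap : ∀ γ → length γ ≡ n → ∀ {a b} → a < b → b < n → start γ ≡ Str (e a) (e b) → Gap (start γ)
    ordered-gap γ len {a} {b} a<b b<n eq with <-cmp (d + d) n
      where d = b ∸ a
    ... | tri< d+d<n _ _ = gap (m<n⇒0<n∸m a<b) d+d<n a
      (trans eq (cong (λ k → Str (e a) (e k)) (sym (m∸n+n≡m (<⇒≤ a<b)))))
    -- After d steps the two points have changed places, which is already the same string.
    ... | tri≈ _ d+d≡n _ = contradiction (begin
      iterate K (start γ) d            ≡⟨ cong (λ s → iterate K s d) eq ⟩
      iterate K (Str (e a) (e b)) d    ≡⟨ iterate-K-Str d (e-< a) (e-< b) (λ p → <⇒≢ a<b (e-injective (<-trans a<b b<n) b<n p)) ⟩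
      Str (iterate t (e a) d) (iterate t (e b) d) ≡⟨ cong₂ Str (iterate-+ t 0 a d) (iterate-+ t 0 b d) ⟨
      Str (e (a + d)) (e (b + d))      ≡⟨ cong₂ (λ k l → Str (e k) (e l)) a+d≡b b+d≡n+a ⟩
      Str (e b) (e (n + a))            ≡⟨ cong (Str (e b)) (pair-wrap 0 a) ⟩
      Str (e b) (e a)                  ≡⟨ Str-comm (e b) (e a) ⟩
      Str (e a) (e b)                  ≡⟨ eq ⟨
      start γ                          ∎)
      (minimal γ d (m<n⇒0<n∸m a<b) (≤-<-trans (m∸n≤m b a) (subst (b <_) (sym len) b<n)))
      where
      open ≡-Reasoning
      d = b ∸ a
      a+d≡b : a + d ≡ b
      a+d≡b = m+[n∸m]≡n (<⇒≤ a<b)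
      b+d≡n+a : b + d ≡ n + a
      b+d≡n+a = begin
        b + d     ≡⟨ cong (_+ d) a+d≡b ⟨
        a + d + d ≡⟨ +-assoc a d d ⟩
        a + (d + d) ≡⟨ cong (λ k → a + k) d+d≡n ⟩
        a + n     ≡⟨ +-comm a n ⟩
        n + a     ∎
    -- Take `b` as the first point; n - d further steps wrap around to `a`.
    ... | tri> _ _ n<d+d = gap (m<n⇒0<n∸m d<n) small b (trans eq (trans (Str-comm (e a) (e b)) (cong (Str (e b)) (sym (begin
      e (n ∸ d + b)       ≡⟨ cong (λ k → e (n ∸ d + k)) (m∸n+n≡m (<⇒≤ a<b)) ⟨
      e (n ∸ d + (d + a)) ≡⟨ cong e (+-assoc (n ∸ d) d a) ⟨
      e (n ∸ d + d + a)   ≡⟨ cong (λ k → e (k + a)) (m∸n+n≡m (<⇒≤ d<n)) ⟩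
      e (n + a)           ≡⟨ pair-wrap 0 a ⟩
      e a                 ∎)))))
      where
      open ≡-Reasoning
      d = b ∸ a
      d<n : d < n
      d<n = ≤-<-trans (m∸n≤m b a) b<n
      small : n ∸ d + (n ∸ d) < n
      small = subst (n ∸ d + (n ∸ d) <_) (m∸n+n≡m (<⇒≤ d<n))
        (+-monoʳ-< (n ∸ d) (+-cancelʳ-< d _ _ (subst (_< d + d) (sym (m∸n+n≡m (<⇒≤ d<n))) n<d+d)))

    cycle-gap : ∀ γ → length γ ≡ n → Gap (start γ)
    cycle-gap γ len with cycle-normal γ
    ... | normal i<n j<n i≢j eq with e-surjective i<n | e-surjective j<n
    ...   | a , a<n , refl | b , b<n , refl with <-cmp a b
    ...     | tri< a<b _ _ = ordered-gap γ len a<b b<n eq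
    ...     | tri≈ _ refl _ = contradiction refl i≢j
    ...     | tri> _ _ b<a = ordered-gap γ len b<a a<n (trans eq (Str-comm (e a) (e b)))

    -- Index i stands for the gap i + 1. With `unhalve`, the admissible gaps 0 < d < n / 2
    -- correspond to `Fin (m / 2)`.
    halve : ∀ {i} → i < m / 2 → suc i + suc i < n
    halve {i} i<m/2 = s≤s (begin
      suc i + suc i ≡⟨ 2*-double (suc i) ⟨
      2 * suc i     ≡⟨ *-comm 2 (suc i) ⟩
      suc i * 2     ≤⟨ *-monoˡ-≤ 2 i<m/2 ⟩
      m / 2 * 2     ≤⟨ m/n*n≤m m 2 ⟩
      m             ∎)
      where open ≤-Reasoning

    unhalve : ∀ {i} → suc i + suc i < n → i < m / 2
    unhalve {i} lt = begin
      suc i             ≡⟨ m*n/n≡m (suc i) 2 ⟨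
      suc i * 2 / 2     ≡⟨ cong (_/ 2) (trans (*-comm (suc i) 2) (2*-double (suc i))) ⟩
      (suc i + suc i) / 2 ≤⟨ /-monoˡ-≤ 2 (s≤s⁻¹ lt) ⟩
      m / 2             ∎
      where open ≤-Reasoning

    cycle-count : HasCardinality (cyclesOfLength B n) (m / 2)
    cycle-count = record
      { to        = λ f → cycle f , refl
      ; cong      = λ { {f} refl → Setoid.refl (cyclesOfLength B n) {cycle f , refl} }
      ; bijective = injective , surjective
      }
      where
      cycle : Fin (m / 2) → TerminalCycle B
      cycle f = gap-cycle {suc (toℕ f)} z<s (halve (Fin.toℕ<n f))

      injective : ∀ {f g} → (∀ {s} → orbit B (cycle f) s → orbit B (cycle g) s) ×
                            (∀ {s} → orbit B (cycle g) s → orbit B (cycle f) s) → f ≡ g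
      injective {f} {g} (_ , ⊇) with ⊇ (0 , refl)
      ... | k , eq = Fin.toℕ-injective (suc-injective (pair-injective z<s (halve (Fin.toℕ<n f)) z<s (halve (Fin.toℕ<n g)) k
        (trans (sym (iterate-pair z<s (halve (Fin.toℕ<n f)) k)) eq)))

      surjective : ∀ (y : Setoid.Carrier (cyclesOfLength B n)) → ∃ λ f → ∀ {g} → g ≡ f →
                   Setoid._≈_ (cyclesOfLength B n) (cycle g , refl) y
      surjective (γ , len) with cycle-gap γ len
      -- The start of the given cycle lies `a` steps after the start of the gap cycle, so the two
      -- orbits coincide.
      ... | gap {suc d} _ lt a eq = fromℕ< (unhalve lt) , λ { refl → orbit-≐ (cycle f) γ a
        (trans (iterate-pair z<s (halve (Fin.toℕ<n f)) a)
        (trans (cong (λ d → pair (suc d) a) (Fin.toℕ-fromℕ< (unhalve lt))) (sym eq))) }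
        where f = fromℕ< (unhalve lt)

corollary1p3 :
    (B : ℕ) .{{_ : NonZero B}} → 3 < B → 2 ∤ B →
    (cmax : ℕ) → IsLargestCycleLength B cmax →
    cmax ≡ (B ∸ 1) / 2 →
    Prime B × HasCardinality (cyclesOfLength B cmax) ((cmax ∸ 1) / 2)
corollary1p3 B 3<B 2∤B cmax ((γ , len) , _) cmax≡ with even-or-odd B
... | inj₁ (i , refl) = contradiction (subst (2 ∣_) (2*-double i) (m∣m*n i)) 2∤B
... | inj₂ (zero        , refl) = contradiction 3<B λ { (s≤s ()) }
... | inj₂ (suc zero    , refl) = contradiction 3<B (n≮n 3)
-- Matching on `refl` replaces `cmax` by n, since (n + n) / 2 computes to n.
... | inj₂ (n@(suc m@(suc _)) , refl) with refl ← trans cmax≡ (trans (cong (_/ 2) (trans (sym (2*-double n)) (*-comm 2 n))) (m*n/n≡m n 2)) =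
  odd-n-prime , cycle-count
  where
  open Cycles m z<s
  -- The given cycle of length n keeps 1 from returning in fewer than n steps.
  0-period : ∀ k → 0 < k → iterate (Doubling.t n) 0 k ≡ 0 → n ≤ k
  0-period k 0<k eq = subst (_≤ k) len (length≤period γ k 0<k eq)
  open Doubling.FullPeriod n z<s 0-period
  open Count 0-period
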